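{- Let $\Sigma$ be a first-order language and let $\mathcal{T}_\Sigma$ be the family of all complete theories in $\Sigma$ (in the sense described in the context). Then $\mathcal{T}_\Sigma$ is $e$-minimal if and only if either $\Sigma=\emptyset$ or $\Sigma$ consists of exactly one constant symbol.
   Context: Theories are complete consistent first-order theories; structures have nonempty universes. If $\Sigma$ is relational, $\mathcal{T}_\Sigma$ is the family of all complete theories of $\Sigma$-structures. If $\Sigma$ contains function symbols (constants being $0$-ary function symbols), each $n$-ary function symbol $f$ is replaced by an $(n+1)$-ary predicate symbol $R_f$ interpreted as the graph $\{(\bar a,b)\mid f(\bar a)=b\}$, and $\mathcal{T}_\Sigma$ is the family of all complete theories of $\Sigma$-structures viewed in this relational language $\Sigma'$. For a family $\mathcal{T}$ of theories and a sentence $\varphi$ of its language, $\mathcal{T}_\varphi=\{T\in\mathcal{T}\mid \varphi\in T\}$. A family $\mathcal{T}$ is called $e$-minimal if it is infinite and for every sentence $\varphi$ of its language, $\mathcal{T}_\varphi$ is finite or $\mathcal{T}_{\neg\varphi}$ is finite. -}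

module Defs where

open import Data.Fin.Base using (Fin)
open import Data.List.Base using (List)
import Data.List.Relation.Unary.Enumerates.Setoid as Enumerates
open import Data.Nat.Base using (ℕ; zero; suc)
open import Data.Product.Base using (Σ; ∃; ∃-syntax; _×_; proj₁)
open import Data.Sum.Base using (_⊎_)
open import Data.Vec.Base using (Vec; []; _∷_; lookup; map; init; last)
open import Level using (Level; _⊔_) renaming (suc to lsuc)
open import Relation.Binary.Bundles using (Setoid)
import Relation.Binary.Construct.On as On
open import Relation.Binary.PropositionalEquality using (_≡_)
open import Relation.Nullary using (¬_)
open import Relation.Unary using (Pred; _∈_; _≐_)
open import Relation.Unary.Relation.Binary.Equality using (≐-setoid)

-- The index is the arity.
RelLanguage : (ℓ : Level) → Set (lsuc ℓ)
RelLanguage ℓ = ℕ → Set ℓ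

record Language (ℓ : Level) : Set (lsuc ℓ) where
  field
    Rel : ℕ → Set ℓ
    Fun : ℕ → Set ℓ

open Language public

data GraphSymbol {ℓ} (L : Language ℓ) : ℕ → Set ℓ where
  rel   : ∀ {n} → Rel L n → GraphSymbol L n
  graph : ∀ {n} → Fun L n → GraphSymbol L (suc n)

-- The relational language Σ′; when Σ has no function symbols, the symbols
-- of Σ′ are just those of Σ.
relational : ∀ {ℓ} → Language ℓ → RelLanguage ℓ
relational = GraphSymbol

infix  8 _≈′_
infixr 6 _∧′_
infix  7 ¬′_ ∃′_

-- Formulas with free variables among Fin n (de Bruijn indices).  Equality is
-- a logical symbol; ∨, ⇒ and ∀ are the classical abbreviations.
data Formula {ℓ} (R : RelLanguage ℓ) (n : ℕ) : Set ℓ where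
  _≈′_ : Fin n → Fin n → Formula R n
  atom : ∀ {k} → R k → Vec (Fin n) k → Formula R n
  ¬′_  : Formula R n → Formula R n
  _∧′_ : Formula R n → Formula R n → Formula R n
  ∃′_  : Formula R (suc n) → Formula R n

Sentence : ∀ {ℓ} → RelLanguage ℓ → Set ℓ
Sentence R = Formula R 0

record RelStructure {ℓ} (R : RelLanguage ℓ) : Set (lsuc ℓ) where
  field
    Carrier   : Set ℓ
    inhabited : Carrier
    ⟦_⟧ʳ      : ∀ {n} → R n → Vec Carrier n → Set ℓ

record Structure {ℓ} (L : Language ℓ) : Set (lsuc ℓ) where
  field
    Carrier   : Set ℓ
    inhabited : Carrier
    ⟦_⟧ʳ      : ∀ {n} → Rel L n → Vec Carrier n → Set ℓ
    ⟦_⟧ᶠ      : ∀ {n} → Fun L n → Vec Carrier n → Carrier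

toRelStructure : ∀ {ℓ} {L : Language ℓ} → Structure L → RelStructure (relational L)
toRelStructure M = record
  { Carrier   = Carrier
  ; inhabited = inhabited
  ; ⟦_⟧ʳ      = λ { (rel r)   xs → ⟦ r ⟧ʳ xs
                  ; (graph f) xs → ⟦ f ⟧ᶠ (init xs) ≡ last xs }
  }
  where open Structure M

module _ {ℓ} {R : RelLanguage ℓ} (M : RelStructure R) where
  open RelStructure M

  Sat : ∀ {n} → Vec Carrier n → Formula R n → Set ℓ
  Sat ρ (i ≈′ j)    = lookup ρ i ≡ lookup ρ j
  Sat ρ (atom r is) = ⟦ r ⟧ʳ (map (lookup ρ) is)
  Sat ρ (¬′ φ)      = ¬ Sat ρ φ
  Sat ρ (φ ∧′ ψ)    = Sat ρ φ × Sat ρ ψ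
  Sat ρ (∃′ φ)      = ∃[ x ] Sat (x ∷ ρ) φ

Theory : ∀ {ℓ} → RelLanguage ℓ → Set (lsuc ℓ)
Theory {ℓ} R = Pred (Sentence R) ℓ

Th : ∀ {ℓ} {R : RelLanguage ℓ} → RelStructure R → Theory R
Th M φ = Sat M [] φ

Family : ∀ {ℓ} → RelLanguage ℓ → Set (lsuc (lsuc ℓ))
Family {ℓ} R = Pred (Theory R) (lsuc ℓ)

-- The members of a family; two of them are equal when they contain the same
-- sentences.
members : ∀ {ℓ} {R : RelLanguage ℓ} → Family R → Setoid (lsuc ℓ) ℓ
members {ℓ} {R} 𝒯 = On.setoid {B = ∃ 𝒯} (≐-setoid (Sentence R) ℓ) proj₁

Finite : ∀ {ℓ} {R : RelLanguage ℓ} → Family R → Set (lsuc ℓ)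
Finite 𝒯 = ∃[ Ts ] Enumerates.IsEnumeration (members 𝒯) Ts

Infinite : ∀ {ℓ} {R : RelLanguage ℓ} → Family R → Set (lsuc ℓ)
Infinite 𝒯 = ¬ Finite 𝒯

_⟨_⟩ : ∀ {ℓ} {R : RelLanguage ℓ} → Family R → Sentence R → Family R
(𝒯 ⟨ φ ⟩) T = T ∈ 𝒯 × φ ∈ T

EMinimal : ∀ {ℓ} {R : RelLanguage ℓ} → Family R → Set (lsuc ℓ)
EMinimal 𝒯 = Infinite 𝒯 × (∀ φ → Finite (𝒯 ⟨ φ ⟩) ⊎ Finite (𝒯 ⟨ ¬′ φ ⟩))

allTheories : ∀ {ℓ} (L : Language ℓ) → Family (relational L)
allTheories L T = ∃[ M ] T ≐ Th (toRelStructure {L = L} M)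

IsEmpty : ∀ {ℓ} → Language ℓ → Set ℓ
IsEmpty L = (∀ n → ¬ Rel L n) × (∀ n → ¬ Fun L n)

IsSingleConstant : ∀ {ℓ} → Language ℓ → Set ℓ
IsSingleConstant L =
  (∀ n → ¬ Rel L n) × (∀ n → ¬ Fun L (suc n)) × (Σ (Fun L 0) λ c → ∀ d → d ≡ c)

{-# OPTIONS --safe #-}
-- The theories of the structures of sizes 2, 3, … are pairwise distinct, being
-- separated by the sentences "at most k elements".  If Σ has a relation symbol,
-- a function symbol of positive arity or two constants, some sentence holds in
-- such a sequence of structures and fails in another, so both halves of 𝒯_Σ are
-- infinite.  Otherwise an Ehrenfeucht–Fraïssé game shows that all structures
-- large enough for the quantifier rank of φ agree on φ; hence one of φ, ¬ φ has
-- only models of bounded size, and each of these is isomorphic to a structure on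
-- some Fin (suc k) with one element marked as the value of every constant.
module Submission where

open import Defs
open import Axiom.ExcludedMiddle using (ExcludedMiddle)
open import Data.Empty.Polymorphic using (⊥)
open import Data.Fin.Base using (Fin; zero; suc; toℕ)
open import Data.Fin.Properties using (_≟_; any?; pigeonhole)
  renaming (<⇒≢ to Fin<⇒≢)
open import Data.List.Base as List using (List; allFin; concatMap; mapMaybe; upTo)
open import Data.List.Membership.Propositional using (lose)
open import Data.List.Membership.Propositional.Properties
  using (∈-allFin; ∈-concatMap⁺; ∈-map⁺; ∈-upTo⁺)
open import Data.List.Membership.Setoid.Properties using (index-injective)
open import Data.List.Relation.Unary.Any as Any using (Any)
open import Data.List.Relation.Unary.Any.Properties as Anyₚ using (mapMaybe⁺)
open import Data.Maybe.Base using (Maybe; just; nothing)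
import Data.Maybe.Relation.Unary.Any as MAny
open import Data.Nat.Base using (ℕ; zero; suc; _+_; _⊔_; _≤_; _<_; s<s; s≤s)
open import Data.Nat.Properties
  using (≤-refl; ≤-trans; ≤-reflexive; <⇒≤; m<n⇒m<1+n; m≤n+m; m⊔n≤o⇒m≤o; m⊔n≤o⇒n≤o;
         +-suc; +-identityʳ)
open import Data.Product.Base using (∃; ∃-syntax; _×_; _,_; proj₁; proj₂)
open import Data.Product.Function.NonDependent.Propositional using (_×-⇔_)
open import Data.Sum.Base using (_⊎_; inj₁; inj₂)
open import Data.Unit.Polymorphic using (⊤; tt)
open import Data.Vec.Base as Vec using (Vec; []; _∷_; last; lookup; replicate; tabulate)
open import Data.Vec.Properties using (lookup∘tabulate)
open import Function.Base using (_∘_; _$_; case_of_)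
open import Function.Bundles using (_⇔_; mk⇔; module Equivalence)
open import Function.Construct.Composition using (_⇔-∘_)
open import Function.Construct.Symmetry using (⇔-sym)
open import Function.Definitions using (Injective)
open import Function.Related.TypeIsomorphisms using (¬-cong-⇔)
open import Level using (Level; Lift; lift; lower)
open import Relation.Binary.PropositionalEquality
open import Relation.Nullary using (¬_; yes; no; contradiction)
open import Relation.Nullary.Decidable using (decidable-stable)
open import Relation.Unary using (_∈_; _≐_)
open import Relation.Unary.Properties using (≐-refl; ≐-sym; ≐-trans)

open Equivalence using (to; from)

private variable
  ℓ : Level
  L : Language ℓ
  R : RelLanguage ℓ
  m n : ℕ

Fin⁺ : ∀ ℓ → ℕ → Set ℓ
Fin⁺ ℓ k = Lift ℓ (Fin (suc k))

Theory-of : Structure L → Theory (relational L)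
Theory-of M = Th (toRelStructure M)

infix 4 _⊨_
_⊨_ : Structure L → Sentence (relational L) → Set _
M ⊨ φ = φ ∈ Theory-of M

-- Sentences bounding the number of elements.

-- The syntax has no constant for truth; a nonempty context lets `zero ≈′ zero` serve as the empty
-- conjunction.
⋀ : ∀ m → (Fin m → Formula R (suc n)) → Formula R (suc n)
⋀ zero    φ = zero ≈′ zero
⋀ (suc m) φ = φ zero ∧′ ⋀ m (φ ∘ suc)

∃⋆ : ∀ k → Formula R k → Sentence R
∃⋆ zero    φ = φ
∃⋆ (suc k) φ = ∃⋆ k (∃′ φ)

module _ {ℓ} {R : RelLanguage ℓ} (M : RelStructure R) where
  open RelStructure M

  Sat-⋀ : ∀ m (φ : Fin m → Formula R (suc n)) {ρ : Vec Carrier (suc n)} →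
          Sat M ρ (⋀ m φ) ⇔ (∀ i → Sat M ρ (φ i))
  Sat-⋀ zero    φ = mk⇔ (λ _ ()) (λ _ → refl)
  Sat-⋀ (suc m) φ = mk⇔
    (λ { (p , ps) zero → p ; (p , ps) (suc i) → to (Sat-⋀ m _) ps i })
    (λ p → p zero , from (Sat-⋀ m _) (p ∘ suc))

  Sat-∃⋆ : ∀ k (φ : Formula R k) → Sat M [] (∃⋆ k φ) ⇔ (∃[ ρ ] Sat M ρ φ)
  Sat-∃⋆ zero    φ = mk⇔ ([] ,_) (λ { ([] , p) → p })
  Sat-∃⋆ (suc k) φ =
    mk⇔ (λ { (ρ , x , p) → x ∷ ρ , p }) (λ { (x ∷ ρ , p) → ρ , x , p })
    ⇔-∘ Sat-∃⋆ k (∃′ φ)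

fresh : ∀ k → Formula R (suc k)
fresh k = ⋀ k λ i → ¬′ (zero ≈′ suc i)

-- Covering is put negatively, as the lack of a further element, which needs neither disjunction nor
-- a universal quantifier.
atMost : ℕ → Sentence R
atMost k = ∃⋆ k (¬′ ∃′ fresh k)

module _ {ℓ} {R : RelLanguage ℓ} (M : RelStructure R) where
  open RelStructure M

  Sat-atMost : ∀ k → Sat M [] (atMost k) ⇔
               (∃[ ρ ] ¬ (∃[ x ] ∀ (i : Fin k) → x ≢ lookup ρ i))
  Sat-atMost k =
    mk⇔ (λ (ρ , h) → ρ , λ (x , p) → h (x , from (Sat-⋀ M k _) p))
        (λ (ρ , h) → ρ , λ (x , p) → h (x , to (Sat-⋀ M k _) p))
    ⇔-∘ Sat-∃⋆ M k _

-- Finite structures of growing size.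

onFin : ∀ {ℓ} {L : Language ℓ} (k : ℕ) → Set ℓ →
        (∀ {n} → Fun L n → Vec (Fin⁺ ℓ k) n → Fin⁺ ℓ k) → Structure L
onFin k P F = record
  { Carrier   = Fin⁺ _ k
  ; inhabited = lift zero
  ; ⟦_⟧ʳ      = λ _ _ → P
  ; ⟦_⟧ᶠ      = F
  }

module _ {ℓ} (L : Language ℓ) (k : ℕ) (P : Set ℓ)
         (F : ∀ {n} → Fun L n → Vec (Fin⁺ ℓ k) n → Fin⁺ ℓ k) where

  private
    S = onFin {L = L} k P F

  onFin-atMost : S ⊨ atMost (suc k)
  onFin-atMost = from (Sat-atMost (toRelStructure S) (suc k))
    (tabulate lift , λ (lift i , p) → p i (sym (lookup∘tabulate lift i)))

  -- Otherwise each of the k + 1 elements would have its own position among m entries. Decidable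
  -- equality on `Fin` extracts the position from the negative form of covering.
  onFin-¬atMost : m < suc k → ¬ (S ⊨ atMost m)
  onFin-¬atMost {m} m<k+1 h with ρ , covers ← to (Sat-atMost (toRelStructure S) m) h =
    let i , j , i<j , same = pigeonhole m<k+1 (proj₁ ∘ index)
    in Fin<⇒≢ i<j (trans (proj₂ (index i))
         (trans (cong (lower ∘ lookup ρ) same) (sym (proj₂ (index j)))))
    where
    index : ∀ x → ∃[ i ] x ≡ lower (lookup ρ i)
    index x = decidable-stable (any? λ i → x ≟ lower (lookup ρ i))
      λ none → covers (lift x , λ i eq → none (i , cong lower eq))

-- From size 2 on, so that functions and constants have two values to choose from.
sizes⇒infinite : ∀ {ℓ} {L : Language ℓ} (𝒯 : Family (relational L)) (P : Set ℓ)
  (F : ∀ m {n} → Fun L n → Vec (Fin⁺ ℓ (suc m)) n → Fin⁺ ℓ (suc m)) →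
  (∀ m → Theory-of (onFin {L = L} (suc m) P (F m)) ∈ 𝒯) → Infinite 𝒯
sizes⇒infinite {L = L} 𝒯 P F S∈𝒯 (Ts , enum) =
  let i , j , i<j , same = pigeonhole {n = suc (List.length Ts)} ≤-refl (Any.index ∘ enum ∘ T ∘ toℕ)
      Tᵢ≐Tⱼ = index-injective (members 𝒯) {T (toℕ i)} {T (toℕ j)} {Ts}
                (enum (T (toℕ i))) (enum (T (toℕ j))) same
  in onFin-¬atMost L (suc (toℕ j)) P (F (toℕ j)) (s<s (s<s i<j))
       (proj₁ Tᵢ≐Tⱼ {atMost (2 + toℕ i)} (onFin-atMost L (suc (toℕ i)) P (F (toℕ i))))
  where
  T : ℕ → ∃ 𝒯
  T m = _ , S∈𝒯 m

all∋ : (M : Structure L) → Theory-of M ∈ allTheories L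
all∋ M = M , ≐-refl

-- Whichever half is claimed finite, it contains a sequence of structures of unbounded size.
¬EMinimal : ∀ {ℓ} {L : Language ℓ} (φ : Sentence (relational L)) (P Q : Set ℓ)
  (F G : ∀ m {n} → Fun L n → Vec (Fin⁺ ℓ (suc m)) n → Fin⁺ ℓ (suc m)) →
  (∀ m → onFin (suc m) P (F m) ⊨ φ) → (∀ m → ¬ (onFin (suc m) Q (G m) ⊨ φ)) →
  ¬ EMinimal (allTheories L)
¬EMinimal {L = L} φ P Q F G holds fails (_ , split) with split φ
... | inj₁ finite = sizes⇒infinite {L = L} (allTheories L ⟨ φ ⟩) P F (λ m → all∋ _ , holds m) finite
... | inj₂ finite = sizes⇒infinite {L = L} (allTheories L ⟨ ¬′ φ ⟩) Q G (λ m → all∋ _ , fails m) finite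

-- Symbols that prevent e-minimality.

-- Serves to read a graph atom on a diagonal tuple as f(x,...,x) = x.
last-diagonal : ∀ {a} {A : Set a} n (x : A) →
  last (Vec.map (lookup (x ∷ [])) (replicate (suc n) zero)) ≡ x
last-diagonal zero    x = refl
last-diagonal (suc n) x = last-diagonal n x

-- A diagonal instance of r exists when all relations are full and not when all are empty, in any
-- arity.
EMinimal⇒¬Rel : EMinimal (allTheories L) → ∀ n → ¬ Rel L n
EMinimal⇒¬Rel emin n r = ¬EMinimal (∃′ atom (rel r) (replicate n zero)) ⊤ ⊥
  (λ _ _ _ → lift zero) (λ _ _ _ → lift zero)
  (λ m → lift zero , tt) (λ { m (_ , ()) }) emin

-- The separating sentence says f(x,...,x) ≠ x for some x: true for the constant function 0, at x =
-- 1, and false for the first projection.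
EMinimal⇒¬Fun⁺ : ∀ {ℓ} {L : Language ℓ} → EMinimal (allTheories L) → ∀ n → ¬ Fun L (suc n)
EMinimal⇒¬Fun⁺ {ℓ} {L} emin n f =
  ¬EMinimal (∃′ ¬′ atom (graph f) (replicate (2 + n) zero)) ⊤ ⊤ (λ _ _ _ → lift zero) (λ _ _ → proj)
  (λ m → lift (suc zero) , λ eq → case trans eq (last-diagonal (suc n) _) of λ ())
  (λ m (x , moved) → moved (sym (last-diagonal (suc n) x)))
  emin
  where
  proj : ∀ {m n} → Vec (Fin⁺ ℓ m) n → Fin⁺ ℓ m
  proj []      = lift zero
  proj (x ∷ _) = x

-- Distinct symbols c and d may share the value 0, or c alone may be moved to 1; the sentence says
-- that their values coincide.
EMinimal⇒uniqueConstant : ExcludedMiddle ℓ → {L : Language ℓ} →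
  EMinimal (allTheories L) → (c d : Fun L 0) → d ≡ c
EMinimal⇒uniqueConstant em {L} emin c d = decidable-stable em λ d≢c →
  ¬EMinimal (∃′ (atom (graph c) (zero ∷ []) ∧′ atom (graph d) (zero ∷ []))) ⊤ ⊤
    (λ _ _ _ → lift zero) (λ _ f _ → [c↦1] f)
    (λ m → lift zero , refl , refl)
    (λ m (x , p , q) → absurd d≢c (trans p (sym q))) emin
  where
  [c↦1] : ∀ {m n} → Fun L n → Fin⁺ _ (suc m)
  [c↦1] {n = suc _} _ = lift zero
  [c↦1] {n = zero}  e with em {e ≡ c}
  ... | yes _ = lift (suc zero)
  ... | no  _ = lift zero

  absurd : ∀ {m} → d ≢ c → [c↦1] {m} c ≢ [c↦1] d
  absurd d≢c eq with em {c ≡ c} | em {d ≡ c}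
  ... | _       | yes d≡c = d≢c d≡c
  -- `em` does not compute on `c ≡ c`, so its impossible answer must be refuted.
  ... | no c≢c  | no _    = c≢c refl
  ... | yes _   | no _    = case eq of λ ()

-- The two admissible languages.

-- Merges both languages of the theorem, so that games and counting are treated once.
AtMostOneConstant : Language ℓ → Set ℓ
AtMostOneConstant L =
  (∀ n → ¬ Rel L n) × (∀ n → ¬ Fun L (suc n)) × ((c d : Fun L 0) → d ≡ c)

EMinimal⇒atMostOneConstant : ExcludedMiddle ℓ → {L : Language ℓ} →
  EMinimal (allTheories L) → AtMostOneConstant L
EMinimal⇒atMostOneConstant em emin =
  EMinimal⇒¬Rel emin , EMinimal⇒¬Fun⁺ emin , EMinimal⇒uniqueConstant em emin

atMostOneConstant⇔ : ExcludedMiddle ℓ → {L : Language ℓ} →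
  AtMostOneConstant L ⇔ (IsEmpty L ⊎ IsSingleConstant L)
atMostOneConstant⇔ em {L} = mk⇔ split merge
  where
  split : AtMostOneConstant L → IsEmpty L ⊎ IsSingleConstant L
  split (¬rel , ¬fun , unique) with em {Fun L 0}
  ... | yes c = inj₂ (¬rel , ¬fun , c , unique c)
  ... | no ¬c = inj₁ (¬rel , λ { zero → ¬c ; (suc n) → ¬fun n })

  merge : IsEmpty L ⊎ IsSingleConstant L → AtMostOneConstant L
  merge (inj₁ (¬rel , ¬fun)) = ¬rel , ¬fun ∘ suc , λ c → contradiction c (¬fun 0)
  merge (inj₂ (¬rel , ¬fun , c , unique)) = ¬rel , ¬fun , λ d e → trans (unique e) (sym (unique d))

-- Ehrenfeucht-Fraïssé games.

rank : Formula R n → ℕ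
rank (i ≈′ j)    = 0
rank (atom r is) = 0
rank (¬′ φ)      = rank φ
rank (φ ∧′ ψ)    = rank φ ⊔ rank ψ
rank (∃′ φ)      = suc (rank φ)

constant : (M : Structure L) → Fun L 0 → Structure.Carrier M
constant M c = Structure.⟦_⟧ᶠ M c []

-- Equality of quantifier-free types when constants are the only symbols: `named` covers their graph
-- atoms.
record SameType {ℓ} {L : Language ℓ} (M N : Structure L) {n}
         (ρ : Vec (Structure.Carrier M) n) (σ : Vec (Structure.Carrier N) n) : Set ℓ where
  field
    equal : ∀ i j → (lookup ρ i ≡ lookup ρ j) ⇔ (lookup σ i ≡ lookup σ j)
    named : ∀ c i → (constant M c ≡ lookup ρ i) ⇔ (constant N c ≡ lookup σ i)

open SameType

SameType-sym : ∀ {M N : Structure L} {ρ : Vec (Structure.Carrier M) n} {σ} →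
               SameType M N ρ σ → SameType N M σ ρ
SameType-sym s = record { equal = λ i j → ⇔-sym (equal s i j) ; named = λ c i → ⇔-sym (named s c i) }

SameType-∷ : ∀ {M N : Structure L} {ρ : Vec (Structure.Carrier M) n} {σ} {x y} → SameType M N ρ σ →
  (∀ i → (lookup ρ i ≡ x) ⇔ (lookup σ i ≡ y)) →
  (∀ c → (constant M c ≡ x) ⇔ (constant N c ≡ y)) →
  SameType M N (x ∷ ρ) (y ∷ σ)
SameType-∷ s eq nm = record
  { equal = λ { zero    zero    → mk⇔ (λ _ → refl) (λ _ → refl)
              ; zero    (suc j) → mk⇔ (sym ∘ to (eq j) ∘ sym) (sym ∘ from (eq j) ∘ sym)
              ; (suc i) zero    → eq i
              ; (suc i) (suc j) → equal s i j }
  ; named = λ { c zero → nm c ; c (suc i) → named s c i } }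

-- An Ehrenfeucht–Fraïssé game: r is the number of rounds left.
record BackAndForth {ℓ} {L : Language ℓ} (M N : Structure L)
  (I : ℕ → ∀ {n} → Vec (Structure.Carrier M) n → Vec (Structure.Carrier N) n → Set ℓ) : Set ℓ where
  field
    sameType : ∀ {r n} {ρ : Vec _ n} {σ} → I r ρ σ → SameType M N ρ σ
    forth    : ∀ {r n} {ρ : Vec _ n} {σ} → I (suc r) ρ σ → ∀ x → ∃[ y ] I r (x ∷ ρ) (y ∷ σ)
    back     : ∀ {r n} {ρ : Vec _ n} {σ} → I (suc r) ρ σ → ∀ y → ∃[ x ] I r (x ∷ ρ) (y ∷ σ)

module _ {ℓ} {L : Language ℓ} (simple : AtMostOneConstant L) where

  private
    ¬rel   = proj₁ simple
    ¬fun   = proj₁ (proj₂ simple)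
    unique = proj₂ (proj₂ simple)

  module _ {M N : Structure L} {I} (game : BackAndForth M N I) where
    open BackAndForth game

    -- Induction on φ: each quantifier spends one round, and atoms are settled by `sameType`.
    agree : (φ : Formula (relational L) n) → ∀ {r ρ σ} → rank φ ≤ r → I r ρ σ →
            Sat (toRelStructure M) ρ φ ⇔ Sat (toRelStructure N) σ φ
    agree (i ≈′ j)         _   p = equal (sameType p) i j
    agree (atom (rel r) _) _   p = contradiction r (¬rel _)
    agree (atom (graph {zero}  c) (i ∷ [])) _ p = named (sameType p) c i
    agree (atom (graph {suc _} f) _)        _ p = contradiction f (¬fun _)
    agree (¬′ φ)           φ≤r p = ¬-cong-⇔ (agree φ φ≤r p)
    agree (φ ∧′ ψ)         ≤r  p =
      agree φ (m⊔n≤o⇒m≤o (rank φ) (rank ψ) ≤r) p ×-⇔ agree ψ (m⊔n≤o⇒n≤o (rank φ) (rank ψ) ≤r) p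
    agree (∃′ φ)     (s≤s φ≤r) p = mk⇔
      (λ (x , h) → let y , q = forth p x in y , to   (agree φ φ≤r q) h)
      (λ (y , h) → let x , q = back  p y in x , from (agree φ φ≤r q) h)

  agree-all⇒≐ : {M N : Structure L} →
    (∀ φ → (M ⊨ φ) ⇔ (N ⊨ φ)) → Theory-of M ≐ Theory-of N
  agree-all⇒≐ h = (λ {φ} → to (h φ)) , (λ {φ} → from (h φ))

  module _ (em : ExcludedMiddle ℓ) where

    -- Agreement of large structures.

    Embeds : ℕ → Set ℓ → Set ℓ
    Embeds k A = ∃[ e ] Injective {A = Fin k} {B = A} _≡_ _≡_ e

    -- If all k embedded elements were hit, two of them would lie in the same `B i`, which holds at
    -- most one element.
    avoid : ∀ {A : Set ℓ} {k} → Embeds k A → (B : Fin m → A → Set ℓ) →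
            (∀ {i x y} → B i x → B i y → x ≡ y) → m < k → ∃[ y ] ∀ i → ¬ B i y
    avoid (e , e-inj) B B-unique m<k = decidable-stable em λ none →
      let hit : ∀ j → ∃[ i ] B i (e j)
          hit j = decidable-stable em λ ¬hit → none (e j , λ i b → ¬hit (i , b))
          i , j , i<j , same = pigeonhole m<k (proj₁ ∘ hit)
      in Fin<⇒≢ i<j (e-inj (B-unique (proj₂ (hit i))
           (subst (λ h → B h (e j)) (sym same) (proj₂ (hit j)))))

    -- The answer copies x if it is an old entry or the constant, and is otherwise a new element
    -- outside both.
    extend : ∀ {M N : Structure L} {K} → Embeds K (Structure.Carrier N) → suc n < K →
      ∀ {ρ : Vec (Structure.Carrier M) n} {σ} → SameType M N ρ σ →
      ∀ x → ∃[ y ] SameType M N (x ∷ ρ) (y ∷ σ)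
    extend {M = M} {N} large n+1<K {ρ} {σ} s x
      with em {∃[ i ] lookup ρ i ≡ x} | em {∃[ c ] constant M c ≡ x}
    ... | yes (i , refl) | _ = lookup σ i , SameType-∷ s (λ j → equal s j i) (λ c → named s c i)
    ... | no _ | yes (c , refl) = constant N c , SameType-∷ s
      (λ i → mk⇔ (sym ∘ to (named s c i) ∘ sym) (sym ∘ from (named s c i) ∘ sym))
      (λ d → mk⇔ (λ _ → cong (constant N) (unique c d)) (λ _ → cong (constant M) (unique c d)))
    ... | no x∉ρ | no x-unnamed =
      let y , y-new = avoid large Taken taken-unique n+1<K in
      y , SameType-∷ s
        (λ i → mk⇔ (λ p → contradiction (i , p) x∉ρ) (λ q → contradiction q (y-new (suc i))))
        (λ c → mk⇔ (λ p → contradiction (c , p) x-unnamed) (λ q → contradiction (c , q) (y-new zero)))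
      where
      -- The n entries and the constant make n + 1 exclusions. Predicates are used because the
      -- constant may not exist.
      Taken : Fin (suc _) → Structure.Carrier N → Set ℓ
      Taken zero    y = ∃[ c ] constant N c ≡ y
      Taken (suc i) y = lookup σ i ≡ y

      taken-unique : ∀ {i x y} → Taken i x → Taken i y → x ≡ y
      taken-unique {zero}  (c , p) (d , q) = trans (sym p) (trans (cong (constant N) (unique d c)) q)
      taken-unique {suc i} p       q       = trans (sym p) q

    large-agree : ∀ {M N : Structure L} φ →
      Embeds (2 + rank φ) (Structure.Carrier M) → Embeds (2 + rank φ) (Structure.Carrier N) →
      (M ⊨ φ) ⇔ (N ⊨ φ)
    large-agree {M} {N} φ largeM largeN = agree game φ ≤-refl
      (record { equal = λ () ; named = λ _ () } , ≤-reflexive (cong (2 +_) (+-identityʳ (rank φ))))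
      where
      K = 2 + rank φ

      I : ℕ → ∀ {n} → Vec (Structure.Carrier M) n → Vec (Structure.Carrier N) n → Set ℓ
      -- Rounds left plus elements chosen stay constant during play, so the initial bound leaves
      -- room at every move.
      I r {n} ρ σ = SameType M N ρ σ × suc (r + n) < K

      room : ∀ r {n} → suc (suc r + n) < K → suc n < K × suc (r + suc n) < K
      room r {n} h = ≤-trans (s≤s (s≤s (m≤n+m n (suc r)))) h
                   , subst (λ t → suc t < K) (sym (+-suc r n)) h

      game : BackAndForth M N I
      game = record
        { sameType = proj₁
        ; forth = λ {r} (s , h) x → let y , s′ = extend largeN (proj₁ (room r h)) s x
                                    in y , s′ , proj₂ (room r h)
        ; back  = λ {r} (s , h) y → let x , s′ = extend largeM (proj₁ (room r h)) (SameType-sym s) y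
                                    in x , SameType-sym s′ , proj₂ (room r h)
        }

    -- Classification of small structures.

    pointed : ∀ k → Fin (suc k) → Structure L
    pointed k a = onFin k ⊥ (λ _ _ → lift a)

    -- With a chosen as the preimage of the constant, e is an isomorphism; answering along e wins a
    -- game of any length.
    bijection⇒≐ : ∀ {k} (M : Structure L) (e : Fin (suc k) → Structure.Carrier M) →
      Injective _≡_ _≡_ e → (∀ y → ∃[ i ] e i ≡ y) →
      ∃[ a ] Theory-of M ≐ Theory-of (pointed k a)
    bijection⇒≐ {k} M e e-inj e-surj =
      a , ≐-sym (agree-all⇒≐ {M = pointed k a} {N = M} λ φ → agree game φ ≤-refl λ ())
      where
      point : ∃[ a ] ∀ c → e a ≡ constant M c
      point with em {Fun L 0}
      ... | yes c = let a , ea≡c = e-surj (constant M c) in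
                    a , λ d → trans ea≡c (cong (constant M) (unique d c))
      -- Without a constant there is nothing to match, and `zero` is a default.
      ... | no ¬c = zero , λ c → contradiction c ¬c

      a = proj₁ point

      I : ℕ → ∀ {n} → Vec (Fin⁺ ℓ k) n → Vec (Structure.Carrier M) n → Set ℓ
      I _ ρ σ = ∀ i → e (lower (lookup ρ i)) ≡ lookup σ i

      transport : ∀ {x y : Fin⁺ ℓ k} {x′ y′} → e (lower x) ≡ x′ → e (lower y) ≡ y′ → (x ≡ y) ⇔ (x′ ≡ y′)
      transport refl refl = mk⇔ (cong (e ∘ lower)) (cong lift ∘ e-inj)

      I-∷ : ∀ {n} {ρ : Vec (Fin⁺ ℓ k) n} {σ x y} → I 0 ρ σ → e (lower x) ≡ y → I 0 (x ∷ ρ) (y ∷ σ)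
      I-∷ h p zero    = p
      I-∷ h p (suc i) = h i

      game : BackAndForth (pointed k a) M I
      game = record
        { sameType = λ h → record { equal = λ i j → transport (h i) (h j)
                                  ; named = λ c i → transport (proj₂ point c) (h i) }
        ; forth = λ h x → e (lower x) , I-∷ h refl
        ; back  = λ h y → let i , p = e-surj y in lift i , I-∷ h p
        }

    -- An injection is enlarged one value at a time; if no value is left, it is already onto.
    embeds-or-counts : ∀ (A : Set ℓ) K → Embeds K A ⊎
      (∃[ k ] k < K × ∃[ e ] Injective {A = Fin k} {B = A} _≡_ _≡_ e × (∀ y → ∃[ i ] e i ≡ y))
    embeds-or-counts A zero = inj₁ ((λ ()) , λ { {()} })
    embeds-or-counts A (suc K) with embeds-or-counts A K
    ... | inj₂ (k , k<K , count) = inj₂ (k , m<n⇒m<1+n k<K , count)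
    ... | inj₁ (e , e-inj) with em {∃[ y ] ∀ i → e i ≢ y}
    ...   | no none = inj₂ (K , ≤-refl , e , e-inj , λ y →
              decidable-stable em λ y∉e → none (y , λ i p → y∉e (i , p)))
    ...   | yes (y , y∉e) = inj₁ (e⁺ , e⁺-inj)
      where
      e⁺ : Fin (suc K) → A
      e⁺ zero    = y
      e⁺ (suc i) = e i

      e⁺-inj : Injective _≡_ _≡_ e⁺
      e⁺-inj {zero}  {zero}  p = refl
      e⁺-inj {zero}  {suc j} p = contradiction (sym p) (y∉e j)
      e⁺-inj {suc i} {zero}  p = contradiction p (y∉e i)
      e⁺-inj {suc i} {suc j} p = cong suc (e-inj p)

    smallStructures : ℕ → List (Structure L)
    smallStructures K = concatMap (λ k → List.map (pointed k) (allFin (suc k))) (upTo K)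

    small⇒listed : ∀ (M : Structure L) K → ¬ Embeds K (Structure.Carrier M) →
      Any (λ S → Theory-of M ≐ Theory-of S) (smallStructures K)
    small⇒listed M K ¬large with embeds-or-counts (Structure.Carrier M) K
    ... | inj₁ large = contradiction large ¬large
    -- Universes are nonempty, so the count is a successor.
    ... | inj₂ (zero , _ , _ , _ , e-surj) = case e-surj (Structure.inhabited M) of λ ()
    ... | inj₂ (suc k , k<K , e , e-inj , e-surj) =
      let a , M≐S = bijection⇒≐ M e e-inj e-surj
          S∈      = ∈-map⁺ (pointed k) (∈-allFin a)
      in lose (∈-concatMap⁺ _ (lose (∈-upTo⁺ (<⇒≤ k<K)) S∈)) M≐S

    -- Finiteness and e-minimality.

    -- Listed structures failing ψ are filtered out by `em`; one that shares its theory with a model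
    -- of ψ survives.
    listed⇒finite : ∀ ψ (Ss : List (Structure L)) →
      (∀ M → M ⊨ ψ → Any (λ S → Theory-of M ≐ Theory-of S) Ss) →
      Finite (allTheories L ⟨ ψ ⟩)
    listed⇒finite ψ Ss listed = mapMaybe member Ss , enum
      where
      member : Structure L → Maybe (∃ (allTheories L ⟨ ψ ⟩))
      member S with em {S ⊨ ψ}
      ... | yes p = just (Theory-of S , all∋ S , p)
      ... | no  _ = nothing

      member-of : ∀ {T S} → ψ ∈ T → T ≐ Theory-of S → MAny.Any (λ U → T ≐ proj₁ U) (member S)
      member-of {S = S} ψ∈T T≐S with em {S ⊨ ψ}
      ... | yes _ = MAny.just T≐S
      ... | no ¬p = contradiction (proj₁ T≐S ψ∈T) ¬p

      enum : ∀ (T : ∃ (allTheories L ⟨ ψ ⟩)) → Any (λ U → proj₁ T ≐ proj₁ U) (mapMaybe member Ss)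
      enum (T , (M , T≐M) , ψ∈T) = mapMaybe⁺ member Ss $ Anyₚ.map⁺ $
        Any.map (member-of ψ∈T ∘ ≐-trans T≐M) (listed M (proj₁ T≐M ψ∈T))

    bounded⇒finite : ∀ ψ K → (∀ M → Embeds K (Structure.Carrier M) → ¬ (M ⊨ ψ)) →
      Finite (allTheories L ⟨ ψ ⟩)
    bounded⇒finite ψ K bounded =
      listed⇒finite ψ (smallStructures K) λ M M⊨ψ → small⇒listed M K λ large → bounded M large M⊨ψ

    atMostOneConstant⇒EMinimal : EMinimal (allTheories L)
    atMostOneConstant⇒EMinimal =
      sizes⇒infinite {L = L} (allTheories L) ⊥ (λ _ _ _ → lift zero) (λ m → all∋ _) , split
      where
      split : ∀ φ → Finite (allTheories L ⟨ φ ⟩) ⊎ Finite (allTheories L ⟨ ¬′ φ ⟩)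
      -- This structure has exactly 2 + rank φ elements, enough for its verdict on φ to be that of
      -- all large structures.
      split φ with em {pointed (suc (rank φ)) zero ⊨ φ}
      ... | yes p = inj₂ (bounded⇒finite (¬′ φ) (2 + rank φ) λ M large ¬q →
                      ¬q (from (large-agree φ large (lift , cong lower)) p))
      ... | no ¬p = inj₁ (bounded⇒finite φ (2 + rank φ) λ M large q →
                      ¬p (to (large-agree φ large (lift , cong lower)) q))

theorem2p1 : ∀ {ℓ} → ExcludedMiddle ℓ → (L : Language ℓ) →
    EMinimal (allTheories L) ⇔ (IsEmpty L ⊎ IsSingleConstant L)
theorem2p1 em L =
  atMostOneConstant⇔ em
  ⇔-∘ mk⇔ (EMinimal⇒atMostOneConstant em) (λ simple → atMostOneConstant⇒EMinimal simple em)
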